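{- Let $G$ be a $D(k)$ graph and let $C$ be any $\chi_d$-coloring of $G$. Then every color class in $C$ is dominated by some vertex of $G$, and every vertex of $G$ dominates exactly one color class in $C$.
   Context: All graphs are finite, simple and connected. $\gamma(G)$ denotes the domination number and $\chi(G)$ the chromatic number of $G$. A (proper) coloring of $G$ with $k$ colors is a partition $C=(V_1,\dots,V_k)$ of $V(G)$ into nonempty independent sets, called color classes. A vertex $u$ dominates the color class $V_i$ if $u$ is adjacent to every vertex of $V_i$, or if $V_i=\{u\}$. A dominator coloring of $G$ is a coloring in which every vertex dominates at least one color class; the dominator chromatic number $\chi_d(G)$ is the minimum number of colors in a dominator coloring of $G$, and a $\chi_d$-coloring is a dominator coloring with exactly $\chi_d(G)$ colors. A graph $G$ is called a $D(k)$ graph if $\gamma(G)=\chi(G)=\chi_d(G)=k$. -}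

module Defs where

open import Data.Fin.Base using (Fin)
open import Data.Fin.Subset using (Subset; _∈_; ⁅_⁆; ∣_∣; Nonempty)
open import Data.Nat.Base using (ℕ; _≤_)
open import Data.Product using (∃; ∃!; _×_)
open import Data.Sum.Base using (_⊎_)
open import Relation.Binary.Construct.Closure.ReflexiveTransitive using (Star)
open import Relation.Binary.Definitions using (Decidable; Irreflexive; Symmetric)
open import Relation.Binary.PropositionalEquality using (_≡_)
open import Relation.Nullary using (¬_)

-- Adjacency is required to be decidable, as it classically always is.
record SimpleGraph (n : ℕ) : Set₁ where
  infix 4 _~_ _~?_
  field
    _~_      : Fin n → Fin n → Set
    _~?_     : Decidable _~_
    ~-sym    : Symmetric _~_
    ~-irrefl : Irreflexive _≡_ _~_

Connected : ∀ {n} → SimpleGraph n → Set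
Connected G = ∀ u v → Star _~_ u v
  where open SimpleGraph G

IsLeast : (ℕ → Set) → ℕ → Set
IsLeast P m = P m × (∀ j → P j → m ≤ j)

module _ {n : ℕ} (G : SimpleGraph n) where
  open SimpleGraph G

  Dominating : Subset n → Set
  Dominating S = ∀ v → v ∈ S ⊎ ∃ λ u → u ∈ S × u ~ v

  Independent : Subset n → Set
  Independent S = ∀ {u v} → u ∈ S → v ∈ S → ¬ (u ~ v)

  record Coloring (k : ℕ) : Set where
    field
      class       : Fin k → Subset n
      nonempty    : ∀ i → Nonempty (class i)
      partition   : ∀ u → ∃! _≡_ λ i → u ∈ class i
      independent : ∀ i → Independent (class i)

  Dominates : Fin n → Subset n → Set
  Dominates u X = (∀ v → v ∈ X → u ~ v) ⊎ X ≡ ⁅ u ⁆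

  IsDominatorColoring : ∀ {k} → Coloring k → Set
  IsDominatorColoring C = ∀ u → ∃ λ i → Dominates u (class i)
    where open Coloring C

  -- γ, χ and χ_d are rendered as predicates: DominationNumber m reads "γ(G) = m".

  DominationNumber : ℕ → Set
  DominationNumber = IsLeast λ m → ∃ λ S → Dominating S × ∣ S ∣ ≡ m

  ChromaticNumber : ℕ → Set
  ChromaticNumber = IsLeast Coloring

  DominatorChromaticNumber : ℕ → Set
  DominatorChromaticNumber = IsLeast λ m → ∃ λ (C : Coloring m) → IsDominatorColoring C

  Isχd-Coloring : ∀ {m} → Coloring m → Set
  Isχd-Coloring {m} C = IsDominatorColoring C × DominatorChromaticNumber m

  IsD : ℕ → Set
  IsD k = DominationNumber k × ChromaticNumber k × DominatorChromaticNumber k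

{-# OPTIONS --safe #-}
-- A vertex chosen from each class gives a dominating set, and so does a
-- dominator chosen for each class.  As χ_d = γ, neither choice can be made with
-- fewer than χ_d vertices.  A class without a dominator could be skipped in the
-- first choice; a vertex dominating two classes could serve both in the second.
module Submission where

open import Defs
open import Data.Bool.Properties using () renaming (_≟_ to _≟ᵇ_)
open import Data.Fin.Base using (Fin; zero; suc; punchIn; punchOut)
open import Data.Fin.Properties using (_≟_; all?; any?; punchIn-punchOut)
open import Data.Fin.Subset using (Subset; inside; outside; _∈_; ⁅_⁆; ∣_∣; ⊥; _∪_)
open import Data.Fin.Subset.Properties
  using (_∈?_; ∣⊥∣≡0; ∣⁅x⁆∣≡1; x∈⁅x⁆; x∈⁅y⁆⇒x≡y; x∈p∪q⁺)
open import Data.Nat.Base using (ℕ; zero; suc; _+_; _≤_; z≤n; s≤s)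
open import Data.Nat.Properties
  using (≤-trans; ≤-reflexive; n≤1+n; 1+n≰n; +-monoʳ-≤; +-suc; module ≤-Reasoning)
open import Data.Product using (∃; ∃!; _×_; _,_; proj₁; proj₂)
open import Data.Sum.Base using (_⊎_; inj₁; inj₂)
open import Data.Vec.Base using ([]; _∷_)
open import Data.Vec.Properties using (≡-dec)
open import Function.Base using (_∘_)
open import Relation.Binary.PropositionalEquality
  using (_≡_; _≢_; refl; sym; cong; subst)
open import Relation.Nullary using (¬_; Dec; yes; no; contradiction)
open import Relation.Nullary.Decidable using (_⊎-dec_; _→-dec_)

∣p∪q∣≤∣p∣+∣q∣ : ∀ {n} (p q : Subset n) → ∣ p ∪ q ∣ ≤ ∣ p ∣ + ∣ q ∣
∣p∪q∣≤∣p∣+∣q∣ []            []            = z≤n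
∣p∪q∣≤∣p∣+∣q∣ (outside ∷ p) (outside ∷ q) = ∣p∪q∣≤∣p∣+∣q∣ p q
∣p∪q∣≤∣p∣+∣q∣ (outside ∷ p) (inside  ∷ q) =
  ≤-trans (s≤s (∣p∪q∣≤∣p∣+∣q∣ p q)) (≤-reflexive (sym (+-suc ∣ p ∣ ∣ q ∣)))
∣p∪q∣≤∣p∣+∣q∣ (inside  ∷ p) (outside ∷ q) = s≤s (∣p∪q∣≤∣p∣+∣q∣ p q)
∣p∪q∣≤∣p∣+∣q∣ (inside  ∷ p) (inside  ∷ q) =
  s≤s (≤-trans (∣p∪q∣≤∣p∣+∣q∣ p q) (+-monoʳ-≤ ∣ p ∣ (n≤1+n ∣ q ∣)))

image : ∀ {n j} → (Fin j → Fin n) → Subset n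
image {j = zero}  g = ⊥
image {j = suc j} g = ⁅ g zero ⁆ ∪ image (g ∘ suc)

∈-image : ∀ {n j} (g : Fin j → Fin n) i → g i ∈ image g
∈-image g zero    = x∈p∪q⁺ (inj₁ (x∈⁅x⁆ (g zero)))
∈-image g (suc i) = x∈p∪q⁺ (inj₂ (∈-image (g ∘ suc) i))

∣image∣≤ : ∀ {n j} (g : Fin j → Fin n) → ∣ image g ∣ ≤ j
∣image∣≤ {n} {zero}  g = ≤-reflexive (∣⊥∣≡0 n)
∣image∣≤ {n} {suc j} g = begin
  ∣ ⁅ g zero ⁆ ∪ image (g ∘ suc) ∣         ≤⟨ ∣p∪q∣≤∣p∣+∣q∣ ⁅ g zero ⁆ _ ⟩
  ∣ ⁅ g zero ⁆ ∣ + ∣ image (g ∘ suc) ∣     ≡⟨ cong (_+ ∣ image (g ∘ suc) ∣) (∣⁅x⁆∣≡1 (g zero)) ⟩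
  suc ∣ image (g ∘ suc) ∣                  ≤⟨ s≤s (∣image∣≤ (g ∘ suc)) ⟩
  suc j                                    ∎
  where
  open ≤-Reasoning

module _ {n : ℕ} (G : SimpleGraph n) where
  open SimpleGraph G

  -- Closed neighbourhoods put both clauses of `Dominates` on one footing. The relation is
  -- symmetric, so a chosen vertex can be reached either from a dominator of its class or from a
  -- member of the class it dominates.
  Near : Fin n → Fin n → Set
  Near u v = u ≡ v ⊎ u ~ v

  near-sym : ∀ {u v} → Near u v → Near v u
  near-sym (inj₁ u≡v) = inj₁ (sym u≡v)
  near-sym (inj₂ u~v) = inj₂ (~-sym u~v)

  dominates⇒near : ∀ {u v X} → Dominates G u X → v ∈ X → Near u v
  dominates⇒near (inj₁ u~X)  v∈X = inj₂ (u~X _ v∈X)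
  dominates⇒near (inj₂ refl) v∈X = inj₁ (sym (x∈⁅y⁆⇒x≡y _ v∈X))

  dominates? : ∀ u X → Dec (Dominates G u X)
  dominates? u X =
    all? (λ v → (v ∈? X) →-dec (u ~? v)) ⊎-dec ≡-dec _≟ᵇ_ X ⁅ u ⁆

  -- The image of `g` is a dominating set. As `g` may repeat vertices, its size is only bounded by
  -- `j`, which suffices.
  γ≤-family : ∀ {k j} → DominationNumber G k → (g : Fin j → Fin n) →
              (∀ v → ∃ λ i → Near (g i) v) → k ≤ j
  γ≤-family (_ , least) g near =
    ≤-trans (least _ (image g , dominating , refl)) (∣image∣≤ g)
    where
    dominating : Dominating G (image g)
    dominating v with near v
    ... | i , inj₁ refl = inj₁ (∈-image g i)
    ... | i , inj₂ gi~v = inj₂ (g i , ∈-image g i , gi~v)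

  -- Deleting index `i` with `punchIn i` would leave a dominating family of `m - 1` vertices, fewer
  -- than `k`. Having an `i` at all forces `m` to be a successor.
  no-redundant-index : ∀ {k m} → DominationNumber G k → m ≤ k →
                       (g : Fin m → Fin n) (i : Fin m) →
                       ¬ (∀ v → ∃ λ c → i ≢ c × Near (g c) v)
  no-redundant-index {m = suc j} γ m≤k g i near =
    1+n≰n (≤-trans m≤k (γ≤-family γ (g ∘ punchIn i) near′))
    where
    near′ : ∀ v → ∃ λ c → Near (g (punchIn i c)) v
    near′ v with near v
    ... | c , i≢c , gc-v =
      punchOut i≢c , subst (λ c → Near (g c) v) (sym (punchIn-punchOut i≢c)) gc-v

  module _ {k m} (γ : DominationNumber G k) (m≤k : m ≤ k)
           (C : Coloring G m) (dom : IsDominatorColoring G C) where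
    open Coloring C

    class-dominated : ∀ i → ∃ λ u → Dominates G u (class i)
    class-dominated i with any? (λ u → dominates? u (class i))
    ... | yes dominated  = dominated
    ... | no undominated = contradiction near
            (no-redundant-index γ m≤k (proj₁ ∘ nonempty) i)
      where
      near : ∀ v → ∃ λ c → i ≢ c × Near (proj₁ (nonempty c)) v
      near v with dom v
      -- `c` is a class that `v` dominates, so it cannot be the undominated class `i`, and `v` is
      -- near its representative.
      ... | c , v-c = c , (λ { refl → undominated (v , v-c) })
                    , near-sym (dominates⇒near v-c (proj₂ (nonempty c)))

    -- If `i` and `j` differed, `u` could be the dominator chosen for class `j` and cover class `i`
    -- as well, making index `i` redundant.
    dominated-class-unique : ∀ {u i j} → Dominates G u (class i) →
                             Dominates G u (class j) → i ≡ j
    dominated-class-unique {u} {i} {j} u-i u-j with i ≟ j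
    ... | yes i≡j = i≡j
    ... | no i≢j  = contradiction near
            (no-redundant-index γ m≤k (proj₁ ∘ dominator) i)
      where
      -- The last component records in the type that the choice at `j` also dominates class `i`,
      -- since `dominator j` does not reduce to `u` by itself.
      dominator : ∀ c → ∃ λ x → Dominates G x (class c) ×
                                (c ≡ j → Dominates G x (class i))
      dominator c with c ≟ j
      ... | yes refl = u , u-j , λ _ → u-i
      ... | no c≢j   = let x , x-c = class-dominated c in
                       x , x-c , λ c≡j → contradiction c≡j c≢j

      near : ∀ v → ∃ λ c → i ≢ c × Near (proj₁ (dominator c)) v
      near v with partition v
      ... | c , v∈c , _ with i ≟ c
      -- Members of class `i` are redirected to index `j`; all others keep the dominator of their
      -- own class.
      ...   | yes refl = j , i≢j , dominates⇒near (proj₂ (proj₂ (dominator j)) refl) v∈c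
      ...   | no i≢c   = c , i≢c , dominates⇒near (proj₁ (proj₂ (dominator c))) v∈c

theorem1 : ∀ {n} (G : SimpleGraph n) → Connected G →
    ∀ (k : ℕ) → IsD G k →
    ∀ {m} (C : Coloring G m) → Isχd-Coloring G C →
    (∀ i → ∃ λ u → Dominates G u (Coloring.class C i))
    × (∀ u → ∃! _≡_ λ i → Dominates G u (Coloring.class C i))
theorem1 G _ k (γ , _ , χd , _) C (dom , _ , least) =
  -- `χd` holds a dominator coloring with `k` colors, so the minimality of `m` gives `m ≤ k`, where
  -- `k` is also the domination number.
  class-dominated G γ (least k χd) C dom ,
  λ u → let i , u-i = dom u in
        i , u-i , dominated-class-unique G γ (least k χd) C dom u-i
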